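{- For every integer $n\ge 0$, \[ (-1)^n d_{n,q}=\frac{1}{n!}\sum_{m=0}^{n}2^{2n-m}B_{m,q}S_1(n,m). \]
   Context: Let $p$ be a fixed odd prime, $\mathbb{C}_p$ the completion of the algebraic closure of $\mathbb{Q}_p$, with $|p|_p=1/p$. Let $q\in\mathbb{C}_p$ with $|1-q|_p<p^{ -1/(p-1)}$, and $\log$ denotes the $p$-adic logarithm. The $q$-Bernoulli numbers $B_{n,q}$ are defined by \[ \frac{(q-1)+\frac{q-1}{\log q}t}{qe^t-1}=\sum_{n=0}^\infty B_{n,q}\frac{t^n}{n!}. \] The numbers $d_{n,q}$ ($q$-analogues of the Catalan–Daehee numbers) are defined by \[ \frac{q-1+\frac{q-1}{\log q}\cdot\frac12\log(1-4t)}{q\sqrt{1-4t}-1}=\sum_{n=0}^{\infty}d_{n,q}t^n, \] for $t\in\mathbb{C}_p$ with $|t|_p<p^{ -1/(p-1)}$. $S_1(n,m)$ are the Stirling numbers of the first kind, defined by $(x)_n=\sum_{l=0}^n S_1(n,l)x^l$, where $(x)_0=1$ and $(x)_n=x(x-1)\cdots(x-n+1)$ for $n\ge1$. -}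

module Defs where

open import Algebra.Apartness.Bundles using (HeytingField; HeytingCommutativeRing)
open import Algebra.Bundles using (CommutativeRing; Semiring)
import Algebra.Properties.Semiring.Exp as Exp
import Algebra.Properties.Semiring.Mult as Mult
import Algebra.Properties.Semiring.Sum as Sum
open import Data.Fin.Base using (Fin; toℕ)
open import Data.Integer.Base using (+_)
open import Data.Nat.Base as ℕ using (ℕ; zero; suc; NonZero; _!)
open import Data.Nat.Primality using (Prime; prime)
open import Data.Nat.Properties using (_!≢0)
open import Data.Product.Base using (Σ-syntax; ∃-syntax; _×_; proj₁)
open import Data.Rational.Base as ℚ using (ℚ; 1ℚ)
open import Level using (Level; _⊔_) renaming (suc to lsuc)
open import Relation.Binary.PropositionalEquality.Core using (_≡_)

-- The real number 1/(p-1).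
1/[p-1] : (p : ℕ) → Prime p → ℚ
1/[p-1] zero          (prime {{()}} _)
1/[p-1] (suc zero)    (prime {{()}} _)
1/[p-1] (suc (suc k)) _ = (+ 1) ℚ./ suc k

module FieldNotation {c ℓ₁ ℓ₂} (K : HeytingField c ℓ₁ ℓ₂) where
  open HeytingField K public hiding (zero)

  semiring : Semiring c ℓ₁
  semiring = CommutativeRing.semiring
    (HeytingCommutativeRing.commutativeRing heytingCommutativeRing)

  open Exp semiring public using (_^_)
  open Mult semiring public using () renaming (_×_ to _·_)
  open Sum semiring public using (sum-syntax; sum⁺-syntax)

  fromℕ : ℕ → Carrier
  fromℕ n = n · 1#

  monicEval : ∀ n → (Fin n → Carrier) → Carrier → Carrier
  monicEval n a x = x ^ n + ∑[ i < n ] (a i * x ^ toℕ i)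

  IsRational : Carrier → Set ℓ₁
  IsRational x = ∃[ a ] ∃[ b ] ∃[ k ] (fromℕ (suc k) * x ≈ fromℕ a - fromℕ b)

-- The additive valuation v is normalised by |x|ₚ = p^(- v x).  It takes values
-- in ℚ because the value group of ℂₚ is p^ℚ; |0|ₚ = 0 has no finite exponent,
-- so v is defined on nonzero elements only.
module Valuation {c ℓ₁ ℓ₂} (K : HeytingField c ℓ₁ ℓ₂)
  (v : (x : HeytingField.Carrier K) → HeytingField._#_ K x (HeytingField.0# K) → ℚ) where
  open FieldNotation K

  -- |x|ₚ ≤ p^(- r) and |x|ₚ < p^(- r); both hold vacuously at x = 0.
  ∣_∣≤p^-_ : Carrier → ℚ → Set ℓ₂
  ∣ x ∣≤p^- r = (x#0 : x # 0#) → r ℚ.≤ v x x#0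

  ∣_∣<p^-_ : Carrier → ℚ → Set ℓ₂
  ∣ x ∣<p^- r = (x#0 : x # 0#) → r ℚ.< v x x#0

  IsCauchy : (ℕ → Carrier) → Set ℓ₂
  IsCauchy u = ∀ r → ∃[ N ] (∀ m n → N ℕ.≤ m → N ℕ.≤ n → ∣ u m - u n ∣≤p^- r)

  _⟶_ : (ℕ → Carrier) → Carrier → Set ℓ₂
  u ⟶ x = ∀ r → ∃[ N ] (∀ n → N ℕ.≤ n → ∣ u n - x ∣≤p^- r)

  -- ℚₚ, as the closure of ℚ in the complete field K.
  IsPadic : Carrier → Set (c ⊔ ℓ₁ ⊔ ℓ₂)
  IsPadic x = ∀ r → Σ[ y ∈ Carrier ] (IsRational y × ∣ x - y ∣≤p^- r)

  -- The algebraic closure of ℚₚ in K.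
  IsAlgebraic : Carrier → Set (c ⊔ ℓ₁ ⊔ ℓ₂)
  IsAlgebraic x = ∃[ n ] Σ[ a ∈ (Fin (suc n) → Carrier) ]
    ((∀ i → IsPadic (a i)) × monicEval (suc n) a x ≈ 0#)

-- ℂₚ, characterised up to isomorphism of valued fields: a complete valued
-- field over ℚ with v p = 1, in which the elements algebraic over ℚₚ form an
-- algebraically closed, dense subfield.
record PadicComplexField (p : ℕ) (c ℓ₁ ℓ₂ : Level) : Set (lsuc (c ⊔ ℓ₁ ⊔ ℓ₂)) where
  field
    heytingField : HeytingField c ℓ₁ ℓ₂

  open FieldNotation heytingField public

  field
    charZero : ∀ n .{{_ : NonZero n}} → fromℕ n # 0#

    v      : (x : Carrier) → x # 0# → ℚ
    v-cong : ∀ {x y} (x#0 : x # 0#) (y#0 : y # 0#) → x ≈ y → v x x#0 ≡ v y y#0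
    v-*    : ∀ {x y} (x#0 : x # 0#) (y#0 : y # 0#) (xy#0 : x * y # 0#) →
             v (x * y) xy#0 ≡ v x x#0 ℚ.+ v y y#0
    v-+    : ∀ {x y} (x#0 : x # 0#) (y#0 : y # 0#) (x+y#0 : x + y # 0#) →
             v x x#0 ℚ.⊓ v y y#0 ℚ.≤ v (x + y) x+y#0
    v-p    : (p#0 : fromℕ p # 0#) → v (fromℕ p) p#0 ≡ 1ℚ

  open Valuation heytingField v public

  field
    complete : ∀ u → IsCauchy u → ∃[ x ] u ⟶ x
    algebraicallyClosed :
      ∀ n (a : Fin (suc n) → Carrier) → (∀ i → IsAlgebraic (a i)) →
      Σ[ x ∈ Carrier ] (IsAlgebraic x × monicEval (suc n) a x ≈ 0#)
    algebraicDense : ∀ x r → Σ[ y ∈ Carrier ] (IsAlgebraic y × ∣ x - y ∣≤p^- r)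

module CatalanDaehee {p : ℕ} {c ℓ₁ ℓ₂} (ℂₚ : PadicComplexField p c ℓ₁ ℓ₂) where
  open PadicComplexField ℂₚ

  -- #⇒invertible yields an inverse of n - 0 rather than of n itself.
  1/_ : (n : ℕ) .{{_ : NonZero n}} → Carrier
  1/ n = proj₁ (#⇒invertible (charZero n))

  infix 9 _!⁻¹

  _!⁻¹ : ℕ → Carrier
  n !⁻¹ = (1/ (n !)) {{n !≢0}}

  -- Formal power series (and polynomials) in one variable X.
  PowerSeries : Set c
  PowerSeries = ℕ → Carrier

  infix  4 _≋_
  infixl 6 _⊕_ _⊖_
  infixl 7 _⊛_

  _≋_ : PowerSeries → PowerSeries → Set ℓ₁
  f ≋ g = ∀ n → f n ≈ g n

  const : Carrier → PowerSeries
  const a zero    = a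
  const a (suc _) = 0#

  X : PowerSeries
  X 1 = 1#
  X _ = 0#

  _⊕_ _⊖_ _⊛_ : PowerSeries → PowerSeries → PowerSeries
  (f ⊕ g) n = f n + g n
  (f ⊖ g) n = f n - g n
  (f ⊛ g) n = ∑[ i ≤ n ] (f (toℕ i) * g (n ℕ.∸ toℕ i))

  -- f(aX).
  rescale : Carrier → PowerSeries → PowerSeries
  rescale a f n = f n * a ^ n

  -- F = f / g; for g ≠ 0 this determines F, as series over a field form a domain.
  _IsQuotient_/_ : PowerSeries → PowerSeries → PowerSeries → Set ℓ₁
  F IsQuotient f / g = g ⊛ F ≋ f

  -- e^X.
  expₛ : PowerSeries
  expₛ n = n !⁻¹

  -- log (1 + X).
  log1+ₛ : PowerSeries
  log1+ₛ zero    = 0#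
  log1+ₛ (suc n) = (- 1#) ^ n * (1/ suc n)

  -- ℓ is the p-adic logarithm of q.
  IsLog : Carrier → Carrier → Set ℓ₂
  IsLog q ℓ = (λ N → ∑[ k < N ] (log1+ₛ (toℕ k) * (q - 1#) ^ toℕ k)) ⟶ ℓ

  1-4X : PowerSeries
  1-4X = const 1# ⊖ const (fromℕ 4) ⊛ X

  log[1-4X] : PowerSeries
  log[1-4X] = rescale (- fromℕ 4) log1+ₛ

  -- The branch of √(1-4X) with constant term 1.
  Is√[1-4X] : PowerSeries → Set ℓ₁
  Is√[1-4X] s = s 0 ≈ 1# × s ⊛ s ≋ 1-4X

  -- In the next two definitions κ stands for (q - 1) / log q.
  IsQBernoulli : (q κ : Carrier) → (ℕ → Carrier) → Set ℓ₁
  IsQBernoulli q κ B =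
    (λ n → B n * n !⁻¹) IsQuotient
      (const (q - 1#) ⊕ const κ ⊛ X) / (const q ⊛ expₛ ⊖ const 1#)

  IsQCatalanDaehee : (q κ : Carrier) → (ℕ → Carrier) → Set (c ⊔ ℓ₁)
  IsQCatalanDaehee q κ d = Σ[ s ∈ PowerSeries ] (Is√[1-4X] s ×
    d IsQuotient
      (const (q - 1#) ⊕ const κ ⊛ (const (1/ 2) ⊛ log[1-4X])) / (const q ⊛ s ⊖ const 1#))

  -- The polynomial X (X - 1) ⋯ (X - n + 1).
  falling : ℕ → PowerSeries
  falling zero    = const 1#
  falling (suc n) = falling n ⊛ (X ⊖ const (fromℕ n))

  -- Stirling numbers of the first kind, as elements of ℂₚ.
  S₁ : ℕ → ℕ → Carrier
  S₁ n l = falling n l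

{-# OPTIONS --safe #-}
module Submission where

-- The generating function of d is the exponential one of B evaluated at ½ log (1 - 4X): this
-- substitution is a ring homomorphism which sends X to ½ log (1 - 4X) and e^X to
-- √(1 - 4X), and the denominator q √(1 - 4X) - 1 is cancellable, since its constant
-- coefficient q - 1 and its linear coefficient -2q do not both vanish.  The formula
-- is then (log (1 + X))ᵐ / m! = Σₙ S₁(n, m) Xⁿ / n! at -4X.  Substituting
-- log (1 + X) for X is handled through its chain rule: (1 + X) d/dX on the result is
-- d/dX on the argument, and both are derivations, so multiplicativity follows by
-- induction on the coefficient.

open import Defs
open import Algebra.Bundles using (CommutativeRing)
import Algebra.Properties.CommutativeSemiring.Exp as CommutativeExp
import Algebra.Properties.Ring as RingProperties
import Algebra.Properties.Semiring.Exp as SemiringExp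
import Algebra.Properties.Semiring.Mult as SemiringMult
import Algebra.Properties.Semiring.Sum as SemiringSum
import Algebra.Solver.Ring.NaturalCoefficients.Default as SemiringSolver
open import Algebra.Apartness.Bundles using (HeytingField; HeytingCommutativeRing)
open import Data.Fin.Base using (Fin; toℕ)
open import Data.Fin.Properties using (toℕ≤pred[n])
open import Data.Nat.Base as ℕ using (ℕ; zero; suc; NonZero; _!; s≤s)
import Data.Nat.Properties as ℕ
open import Data.Nat.Primality using (Prime)
open import Data.Product.Base using (_,_; proj₁; proj₂; Σ-syntax)
open import Level using (Level)
open import Relation.Binary.PropositionalEquality using (_≢_)
import Relation.Binary.PropositionalEquality as ≡
import Relation.Binary.Reasoning.Setoid as SetoidReasoning

module LogSubstitution {p : ℕ} {c ℓ₁ ℓ₂ : Level} (ℂₚ : PadicComplexField p c ℓ₁ ℓ₂) where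
  open PadicComplexField ℂₚ
  open CatalanDaehee ℂₚ

  commutativeRing : CommutativeRing c ℓ₁
  commutativeRing = HeytingCommutativeRing.commutativeRing
    (HeytingField.heytingCommutativeRing heytingField)

  open CommutativeRing commutativeRing using (ring; commutativeSemiring)
  open RingProperties ring
    using (-‿distribˡ-*; -‿distribʳ-*; +-cancelʳ; -0#≈0#; -‿involutive; -1*x≈-x)
    renaming (x∙y⁻¹≈ε⇒x≈y to x-y≈0⇒x≈y;
              //-rightDividesˡ to [x-y]+y≈x)
  open SetoidReasoning setoid
  open SemiringSum semiring
    using (sum-cong-≋; sum-replicate-zero; *-distribˡ-sum; ∑-distrib-+)
  open SemiringSolver commutativeSemiring using (solve; _:=_; _:+_; _:*_; con)

  -- Inverses of positive integers.

  fromℕ-* : ∀ m n → fromℕ (m ℕ.* n) ≈ fromℕ m * fromℕ n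
  fromℕ-* = SemiringMult.×1-homo-* semiring

  1/-inverseʳ : ∀ n .{{_ : NonZero n}} → fromℕ n * 1/ n ≈ 1#
  1/-inverseʳ n = begin
    fromℕ n * 1/ n          ≈⟨ *-congʳ (trans (+-congˡ -0#≈0#) (+-identityʳ _)) ⟨
    (fromℕ n - 0#) * 1/ n   ≈⟨ proj₂ (proj₂ (#⇒invertible (charZero n))) ⟩
    1#                      ∎

  1/-cancelˡ : ∀ n .{{_ : NonZero n}} x → fromℕ n * (1/ n * x) ≈ x
  1/-cancelˡ n x = trans (sym (*-assoc _ _ _)) (trans (*-congʳ (1/-inverseʳ n)) (*-identityˡ x))

  fromℕ-cancelˡ : ∀ n .{{_ : NonZero n}} {x y} → fromℕ n * x ≈ fromℕ n * y → x ≈ y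
  fromℕ-cancelˡ n {x} {y} eq = begin
    x                      ≈⟨ step x ⟨
    1/ n * (fromℕ n * x)   ≈⟨ *-congˡ eq ⟩
    1/ n * (fromℕ n * y)   ≈⟨ step y ⟩
    y                      ∎
    where
    step : ∀ z → 1/ n * (fromℕ n * z) ≈ z
    step z = trans (solve 3 (λ a b c → a :* (b :* c) := b :* (a :* c)) refl _ _ _)
                   (1/-cancelˡ n z)

  -- Cauchy products

  -- By computation, `(f ⊛ g) (suc n)` is `f 0 * g (suc n) + (tail f ⊛ g) n`, so identities between
  -- Cauchy products go by induction on the coefficient with the left factor left general.
  tail : PowerSeries → PowerSeries
  tail f n = f (suc n)

  0ₛ : PowerSeries
  0ₛ _ = 0#

  scale : Carrier → PowerSeries → PowerSeries
  scale a f n = a * f n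

  ⊛-cong : ∀ {f f′ g g′} → f ≋ f′ → g ≋ g′ → f ⊛ g ≋ f′ ⊛ g′
  ⊛-cong p q zero    = +-congʳ (*-cong (p 0) (q 0))
  ⊛-cong {f} {f′} p q (suc n) =
    +-cong (*-cong (p 0) (q (suc n))) (⊛-cong {tail f} {tail f′} (λ k → p (suc k)) q n)

  ⊛-zeroˡ : ∀ g → 0ₛ ⊛ g ≋ 0ₛ
  ⊛-zeroˡ g zero    = trans (+-identityʳ _) (zeroˡ _)
  ⊛-zeroˡ g (suc n) = trans (+-cong (zeroˡ _) (⊛-zeroˡ g n)) (+-identityˡ _)

  ⊛-distribʳ-⊕ : ∀ h f g → (f ⊕ g) ⊛ h ≋ f ⊛ h ⊕ g ⊛ h
  ⊛-distribʳ-⊕ h f g zero =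
    solve 3 (λ a b c → (a :+ b) :* c :+ con 0 := (a :* c :+ con 0) :+ (b :* c :+ con 0)) refl _ _ _
  ⊛-distribʳ-⊕ h f g (suc n) = trans (+-congˡ (⊛-distribʳ-⊕ h (tail f) (tail g) n))
    (solve 5 (λ a b c d e → (a :+ b) :* c :+ (d :+ e) := (a :* c :+ d) :+ (b :* c :+ e)) refl _ _ _ _ _)

  scale-⊛ : ∀ a f g → scale a f ⊛ g ≋ scale a (f ⊛ g)
  scale-⊛ a f g zero =
    solve 3 (λ a b c → (a :* b) :* c :+ con 0 := a :* (b :* c :+ con 0)) refl _ _ _
  scale-⊛ a f g (suc n) = trans (+-congˡ (scale-⊛ a (tail f) g n))
    (solve 4 (λ a b c d → (a :* b) :* c :+ a :* d := a :* (b :* c :+ d)) refl _ _ _ _)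

  const-⊛ : ∀ a f → const a ⊛ f ≋ scale a f
  const-⊛ a f zero    = +-identityʳ _
  const-⊛ a f (suc n) = trans (+-congˡ (⊛-zeroˡ f n)) (+-identityʳ _)

  -- The mirror image of the defining recursion: it splits off the last summand and shortens the
  -- right factor. Played against the definition, it yields commutativity.
  ⊛-suc : ∀ f g n → (f ⊛ g) (suc n) ≈ f (suc n) * g 0 + (f ⊛ tail g) n
  ⊛-suc f g zero =
    solve 4 (λ a b c d → a :* b :+ (c :* d :+ con 0) := c :* d :+ (a :* b :+ con 0)) refl _ _ _ _
  ⊛-suc f g (suc n) = trans (+-congˡ (⊛-suc (tail f) g n))
    (solve 3 (λ a b c → a :+ (b :+ c) := b :+ (a :+ c)) refl _ _ _)

  ⊛-comm : ∀ f g → f ⊛ g ≋ g ⊛ f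
  ⊛-comm f g zero    = +-congʳ (*-comm _ _)
  ⊛-comm f g (suc n) = begin
    f 0 * g (suc n) + (tail f ⊛ g) n   ≈⟨ +-cong (*-comm _ _) (⊛-comm (tail f) g n) ⟩
    g (suc n) * f 0 + (g ⊛ tail f) n   ≈⟨ ⊛-suc g f n ⟨
    (g ⊛ f) (suc n)                    ∎

  ⊛-distribˡ-⊕ : ∀ h f g → h ⊛ (f ⊕ g) ≋ h ⊛ f ⊕ h ⊛ g
  ⊛-distribˡ-⊕ h f g n = begin
    (h ⊛ (f ⊕ g)) n       ≈⟨ ⊛-comm h (f ⊕ g) n ⟩
    ((f ⊕ g) ⊛ h) n       ≈⟨ ⊛-distribʳ-⊕ h f g n ⟩
    (f ⊛ h ⊕ g ⊛ h) n     ≈⟨ +-cong (⊛-comm f h n) (⊛-comm g h n) ⟩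
    (h ⊛ f ⊕ h ⊛ g) n     ∎

  ⊛-scale : ∀ a f g → f ⊛ scale a g ≋ scale a (f ⊛ g)
  ⊛-scale a f g n = begin
    (f ⊛ scale a g) n   ≈⟨ ⊛-comm f (scale a g) n ⟩
    (scale a g ⊛ f) n   ≈⟨ scale-⊛ a g f n ⟩
    a * (g ⊛ f) n       ≈⟨ *-congˡ (⊛-comm g f n) ⟩
    a * (f ⊛ g) n       ∎

  -- The constant coefficients agree because `g 0` is a unit. Removing their contribution leaves the
  -- same hypothesis, with the same `g`, for the tails, so the argument recurses on the index.
  invertible-⊛-cancelˡ : ∀ g u → g 0 * u ≈ 1# → ∀ {f h} → g ⊛ f ≋ g ⊛ h → f ≋ h
  invertible-⊛-cancelˡ g u g₀u≈1 = go
    where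
    unit-cancel : ∀ {x y} → g 0 * x ≈ g 0 * y → x ≈ y
    unit-cancel {x} {y} eq = begin
      x               ≈⟨ step x ⟨
      u * (g 0 * x)   ≈⟨ *-congˡ eq ⟩
      u * (g 0 * y)   ≈⟨ step y ⟩
      y               ∎
      where
      step : ∀ z → u * (g 0 * z) ≈ z
      step z = trans (solve 3 (λ a b c → a :* (b :* c) := (b :* a) :* c) refl _ _ _)
                     (trans (*-congʳ g₀u≈1) (*-identityˡ z))

    head : ∀ {f h} → g ⊛ f ≋ g ⊛ h → f 0 ≈ h 0
    head eq = unit-cancel (trans (sym (+-identityʳ _)) (trans (eq 0) (+-identityʳ _)))

    go : ∀ {f h} → g ⊛ f ≋ g ⊛ h → f ≋ h
    go eq zero = head eq
    go {f} {h} eq (suc n) = go tails n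
      where
      tails : g ⊛ tail f ≋ g ⊛ tail h
      tails k = +-cancelʳ (g (suc k) * f 0) _ _ (begin
        (g ⊛ tail f) k + g (suc k) * f 0   ≈⟨ +-comm _ _ ⟩
        g (suc k) * f 0 + (g ⊛ tail f) k   ≈⟨ ⊛-suc g f k ⟨
        (g ⊛ f) (suc k)                    ≈⟨ eq (suc k) ⟩
        (g ⊛ h) (suc k)                    ≈⟨ ⊛-suc g h k ⟩
        g (suc k) * h 0 + (g ⊛ tail h) k   ≈⟨ +-congʳ (*-congˡ (head eq)) ⟨
        g (suc k) * f 0 + (g ⊛ tail h) k   ≈⟨ +-comm _ _ ⟩
        (g ⊛ tail h) k + g (suc k) * f 0   ∎)

  -- Here `g` is X times `tail g`, and the factor X is shifted away.
  ⊛-tailˡ : ∀ {g f h} → g 0 ≈ 0# → g ⊛ f ≋ g ⊛ h → tail g ⊛ f ≋ tail g ⊛ h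
  ⊛-tailˡ {g} {f} {h} g₀≈0 eq n = begin
    (tail g ⊛ f) n   ≈⟨ drop f ⟨
    (g ⊛ f) (suc n)  ≈⟨ eq (suc n) ⟩
    (g ⊛ h) (suc n)  ≈⟨ drop h ⟩
    (tail g ⊛ h) n   ∎
    where
    drop : ∀ k → (g ⊛ k) (suc n) ≈ (tail g ⊛ k) n
    drop k = trans (+-congʳ (trans (*-congʳ g₀≈0) (zeroˡ _))) (+-identityˡ _)

  -- Since s² = t², (s + t) s = (s + t) t. The factor s + t has constant coefficient 2, a unit in
  -- characteristic zero, so it cancels.
  sqrt-unique : ∀ {s t} → s 0 ≈ 1# → t 0 ≈ 1# → s ⊛ s ≋ t ⊛ t → s ≋ t
  sqrt-unique {s} {t} s₀ t₀ s²≈t² =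
    invertible-⊛-cancelˡ (s ⊕ t) (1/ 2) unit (λ n → begin
      ((s ⊕ t) ⊛ s) n           ≈⟨ ⊛-distribʳ-⊕ s s t n ⟩
      (s ⊛ s) n + (t ⊛ s) n     ≈⟨ +-cong (s²≈t² n) (⊛-comm t s n) ⟩
      (t ⊛ t) n + (s ⊛ t) n     ≈⟨ +-comm _ _ ⟩
      (s ⊛ t) n + (t ⊛ t) n     ≈⟨ ⊛-distribʳ-⊕ t s t n ⟨
      ((s ⊕ t) ⊛ t) n           ∎)
    where
    unit : (s 0 + t 0) * 1/ 2 ≈ 1#
    unit = trans (*-congʳ (+-cong s₀ (trans t₀ (sym (+-identityʳ 1#))))) (1/-inverseʳ 2)

  -- The tail of a rescaled series is `a` times the rescaled tail; this is how the extra factor `a`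
  -- of degree `suc n` is absorbed.
  rescale-⊛ : ∀ a f g → rescale a (f ⊛ g) ≋ rescale a f ⊛ rescale a g
  rescale-⊛ a f g zero =
    solve 2 (λ b c → (b :* c :+ con 0) :* con 1 := (b :* con 1) :* (c :* con 1) :+ con 0) refl _ _
  rescale-⊛ a f g (suc n) = begin
    (f 0 * g (suc n) + (tail f ⊛ g) n) * (a * a ^ n)
      ≈⟨ solve 5 (λ b c d a e → (b :* c :+ d) :* (a :* e)
                             := (b :* con 1) :* (c :* (a :* e)) :+ a :* (d :* e)) refl _ _ _ _ _ ⟩
    f 0 * 1# * (g (suc n) * (a * a ^ n)) + a * rescale a (tail f ⊛ g) n
      ≈⟨ +-congˡ (*-congˡ (rescale-⊛ a (tail f) g n)) ⟩
    f 0 * 1# * (g (suc n) * (a * a ^ n)) + a * (rescale a (tail f) ⊛ rescale a g) n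
      ≈⟨ +-congˡ (scale-⊛ a (rescale a (tail f)) (rescale a g) n) ⟨
    f 0 * 1# * (g (suc n) * (a * a ^ n)) + (scale a (rescale a (tail f)) ⊛ rescale a g) n
      ≈⟨ +-congˡ (⊛-cong {g = rescale a g} (λ k →
           solve 3 (λ a b c → a :* (b :* c) := b :* (a :* c)) refl a (f (suc k)) (a ^ k)) (λ _ → refl) n) ⟩
    f 0 * 1# * (g (suc n) * (a * a ^ n)) + (tail (rescale a f) ⊛ rescale a g) n  ∎

  -- Derivations

  -- `θ` is the Euler operator X d/dX. It preserves degrees, which makes its Leibniz rule a direct
  -- induction, and `D f` is `tail (θ f)` by computation, so the rule for `D` follows.
  D θ δ : PowerSeries → PowerSeries
  D f n = fromℕ (suc n) * f (suc n)
  θ f n = fromℕ n * f n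
  -- (1 + X) d/dX.
  δ f n = D f n + θ f n

  -- The induction rests on `tail (θ f)` being `tail f ⊕ θ (tail f)`: the additional `tail f` makes
  -- up for the weight rising from n to n + 1.
  θ-⊛ : ∀ f g → θ (f ⊛ g) ≋ θ f ⊛ g ⊕ f ⊛ θ g
  θ-⊛ f g zero = solve 2 (λ a b → con 0 :* (a :* b :+ con 0)
    := ((con 0 :* a) :* b :+ con 0) :+ (a :* (con 0 :* b) :+ con 0)) refl _ _
  θ-⊛ f g (suc n) = begin
    (1# + fromℕ n) * (f 0 * g (suc n) + (tail f ⊛ g) n)
      ≈⟨ solve 4 (λ a b c d → (con 1 :+ a) :* (b :* c :+ d)
                   := b :* ((con 1 :+ a) :* c) :+ (d :+ a :* d)) refl _ _ _ _ ⟩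
    f 0 * θ g (suc n) + ((tail f ⊛ g) n + θ (tail f ⊛ g) n)
      ≈⟨ +-congˡ (+-congˡ (θ-⊛ (tail f) g n)) ⟩
    f 0 * θ g (suc n) + ((tail f ⊛ g) n + ((θ (tail f) ⊛ g) n + (tail f ⊛ θ g) n))
      ≈⟨ solve 4 (λ a b c d → a :+ (b :+ (c :+ d)) := (b :+ c) :+ (a :+ d)) refl _ _ _ _ ⟩
    ((tail f ⊛ g) n + (θ (tail f) ⊛ g) n) + (f 0 * θ g (suc n) + (tail f ⊛ θ g) n)
      ≈⟨ +-congʳ (⊛-distribʳ-⊕ g (tail f) (θ (tail f)) n) ⟨
    ((tail f ⊕ θ (tail f)) ⊛ g) n + (f ⊛ θ g) (suc n)
      ≈⟨ +-congʳ (⊛-cong {g = g} (λ k →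
           solve 2 (λ a b → a :+ b :* a := (con 1 :+ b) :* a) refl (f (suc k)) (fromℕ k)) (λ _ → refl) n) ⟩
    (tail (θ f) ⊛ g) n + (f ⊛ θ g) (suc n)
      ≈⟨ +-congʳ (trans (+-congʳ (trans (*-congʳ (zeroˡ _)) (zeroˡ _))) (+-identityˡ _)) ⟨
    (θ f ⊛ g) (suc n) + (f ⊛ θ g) (suc n)  ∎

  -- This is the rule for `θ` one degree higher. Both `θ f` and `θ g` have zero constant
  -- coefficient, so the first summand of one product and the last summand of the other vanish.
  D-⊛ : ∀ f g → D (f ⊛ g) ≋ D f ⊛ g ⊕ f ⊛ D g
  D-⊛ f g n = begin
    θ (f ⊛ g) (suc n)
      ≈⟨ θ-⊛ f g (suc n) ⟩
    (θ f ⊛ g) (suc n) + (f ⊛ θ g) (suc n)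
      ≈⟨ +-cong (trans (+-congʳ (trans (*-congʳ (zeroˡ _)) (zeroˡ _))) (+-identityˡ _))
                (trans (⊛-suc f (θ g) n)
                  (trans (+-congʳ (trans (*-congˡ (zeroˡ _)) (zeroʳ _))) (+-identityˡ _))) ⟩
    (D f ⊛ g) n + (f ⊛ D g) n  ∎

  δ-⊛ : ∀ f g → δ (f ⊛ g) ≋ δ f ⊛ g ⊕ f ⊛ δ g
  δ-⊛ f g n = begin
    D (f ⊛ g) n + θ (f ⊛ g) n
      ≈⟨ +-cong (D-⊛ f g n) (θ-⊛ f g n) ⟩
    ((D f ⊛ g) n + (f ⊛ D g) n) + ((θ f ⊛ g) n + (f ⊛ θ g) n)
      ≈⟨ solve 4 (λ a b c d → (a :+ b) :+ (c :+ d) := (a :+ c) :+ (b :+ d)) refl _ _ _ _ ⟩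
    ((D f ⊛ g) n + (θ f ⊛ g) n) + ((f ⊛ D g) n + (f ⊛ θ g) n)
      ≈⟨ +-cong (⊛-distribʳ-⊕ g (D f) (θ f) n) (⊛-distribˡ-⊕ f (D g) (θ g) n) ⟨
    (δ f ⊛ g) n + (f ⊛ δ g) n  ∎

  -- Coefficient n of `δ f` is (n + 1) f(n + 1) + n f(n), and n + 1 is invertible. A series is thus
  -- determined by its constant coefficient and its image under `δ`.
  δ-determines-suc : ∀ {f g} n → f n ≈ g n → δ f n ≈ δ g n → f (suc n) ≈ g (suc n)
  δ-determines-suc {f} {g} n fn≈gn eq = fromℕ-cancelˡ (suc n)
    (+-cancelʳ (fromℕ n * f n) _ _ (trans eq (+-congˡ (*-congˡ (sym fn≈gn)))))

  -- Substitution of log (1 + X).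

  -- F = f(log (1 + X)), computed from its chain rule (1 + X) F′ = f′(log (1 + X)).
  substLog : PowerSeries → PowerSeries
  substLog f zero    = f 0
  substLog f (suc n) = 1/ suc n * (substLog (D f) n - fromℕ n * substLog f n)

  δ-substLog : ∀ f → δ (substLog f) ≋ substLog (D f)
  δ-substLog f n = trans (+-congʳ (1/-cancelˡ (suc n) _)) ([x-y]+y≈x _ _)

  substLog-cong : ∀ {f g} → f ≋ g → substLog f ≋ substLog g
  substLog-cong eq zero    = eq 0
  substLog-cong {f} {g} eq (suc n) = *-congˡ (+-cong
    (substLog-cong {D f} {D g} (λ k → *-congˡ (eq (suc k))) n)
    (-‿cong (*-congˡ (substLog-cong eq n))))

  -- The common induction step for computing a substitution: the chain rule trades coefficient n + 1
  -- of `substLog f` for coefficient n of `substLog (D f)`, where an induction hypothesis general in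
  -- `f` is available.
  substLog-suc : ∀ {f g} n → substLog f n ≈ g n → substLog (D f) n ≈ δ g n →
                 substLog f (suc n) ≈ g (suc n)
  substLog-suc {f} {g} n eq eq′ = δ-determines-suc {substLog f} {g} n eq (trans (δ-substLog f n) eq′)

  substLog-⊕ : ∀ f g → substLog (f ⊕ g) ≋ substLog f ⊕ substLog g
  substLog-⊕ f g zero    = refl
  substLog-⊕ f g (suc n) = substLog-suc {f ⊕ g} {substLog f ⊕ substLog g} n (substLog-⊕ f g n) (begin
    substLog (D (f ⊕ g)) n
      ≈⟨ substLog-cong {D (f ⊕ g)} {D f ⊕ D g} (λ _ → distribˡ _ _ _) n ⟩
    substLog (D f ⊕ D g) n
      ≈⟨ substLog-⊕ (D f) (D g) n ⟩
    substLog (D f) n + substLog (D g) n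
      ≈⟨ +-cong (δ-substLog f n) (δ-substLog g n) ⟨
    δ (substLog f) n + δ (substLog g) n
      ≈⟨ solve 6 (λ a b c d e f → (a :* b :+ c :* d) :+ (a :* e :+ c :* f)
                             := a :* (b :+ e) :+ c :* (d :+ f)) refl _ _ _ _ _ _ ⟩
    δ (substLog f ⊕ substLog g) n  ∎)

  substLog-⊛ : ∀ f g → substLog (f ⊛ g) ≋ substLog f ⊛ substLog g
  substLog-⊛ f g zero    = refl
  substLog-⊛ f g (suc n) = substLog-suc {f ⊛ g} {substLog f ⊛ substLog g} n (substLog-⊛ f g n) (begin
    substLog (D (f ⊛ g)) n
      ≈⟨ substLog-cong {D (f ⊛ g)} (D-⊛ f g) n ⟩
    substLog (D f ⊛ g ⊕ f ⊛ D g) n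
      ≈⟨ substLog-⊕ (D f ⊛ g) (f ⊛ D g) n ⟩
    substLog (D f ⊛ g) n + substLog (f ⊛ D g) n
      -- The hypothesis at the same coefficient n, applied to the two pairs in which one factor has
      -- been differentiated.
      ≈⟨ +-cong (substLog-⊛ (D f) g n) (substLog-⊛ f (D g) n) ⟩
    (substLog (D f) ⊛ substLog g) n + (substLog f ⊛ substLog (D g)) n
      ≈⟨ +-cong (⊛-cong {g = substLog g} (δ-substLog f) (λ _ → refl) n)
                (⊛-cong {substLog f} (λ _ → refl) (δ-substLog g) n) ⟨
    (δ (substLog f) ⊛ substLog g) n + (substLog f ⊛ δ (substLog g)) n
      ≈⟨ δ-⊛ (substLog f) (substLog g) n ⟨
    δ (substLog f ⊛ substLog g) n  ∎)


  substLog-⊖ : ∀ f g → substLog (f ⊖ g) ≋ substLog f ⊖ substLog g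
  substLog-⊖ f g n = +-cancelʳ (substLog g n) _ _ (begin
    substLog (f ⊖ g) n + substLog g n            ≈⟨ substLog-⊕ (f ⊖ g) g n ⟨
    substLog ((f ⊖ g) ⊕ g) n                     ≈⟨ substLog-cong {(f ⊖ g) ⊕ g} {f} (λ _ → [x-y]+y≈x _ _) n ⟩
    substLog f n                                 ≈⟨ [x-y]+y≈x _ _ ⟨
    substLog f n - substLog g n + substLog g n   ∎)

  δ-const : ∀ a → δ (const a) ≋ 0ₛ
  δ-const a zero    = trans (+-cong (zeroʳ _) (zeroˡ _)) (+-identityˡ _)
  δ-const a (suc n) = trans (+-cong (zeroʳ _) (zeroʳ _)) (+-identityˡ _)

  substLog-const : ∀ a → substLog (const a) ≋ const a
  substLog-const a zero    = refl
  substLog-const a (suc n) = substLog-suc {const a} {const a} n (substLog-const a n) (begin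
    -- The derivative is written as `const 0#` rather than `0ₛ`, so that the induction hypothesis
    -- for constants applies to it.
    substLog (D (const a)) n   ≈⟨ substLog-cong {D (const a)} {const 0#} D-const n ⟩
    substLog (const 0#) n      ≈⟨ substLog-const 0# n ⟩
    const 0# n                 ≈⟨ const0 n ⟩
    0#                         ≈⟨ δ-const a n ⟨
    δ (const a) n              ∎)
    where
    const0 : const 0# ≋ 0ₛ
    const0 zero    = refl
    const0 (suc _) = refl
    D-const : D (const a) ≋ const 0#
    D-const k = trans (zeroʳ _) (sym (const0 k))

  D-X : D X ≋ const 1#
  D-X zero    = solve 0 ((con 1 :+ con 0) :* con 1 := con 1) refl
  D-X (suc n) = zeroʳ _

  -- (1 + X) times the derivative 1 / (1 + X): in positive degree two consecutive terms of the
  -- alternating geometric series cancel.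
  δ-log1+ : δ log1+ₛ ≋ const 1#
  δ-log1+ zero = begin
    fromℕ 1 * (1# * 1/ 1) + fromℕ 0 * 0#   ≈⟨ +-cong (*-congˡ (*-identityˡ _)) (zeroʳ _) ⟩
    fromℕ 1 * 1/ 1 + 0#                    ≈⟨ trans (+-identityʳ _) (1/-inverseʳ 1) ⟩
    1#                                     ∎
  δ-log1+ (suc n) = begin
    fromℕ (2 ℕ.+ n) * ((- 1#) ^ suc n * 1/ (2 ℕ.+ n)) + fromℕ (1 ℕ.+ n) * ((- 1#) ^ n * 1/ (1 ℕ.+ n))
      ≈⟨ +-cong (coefficient (suc n)) (coefficient n) ⟩
    - 1# * (- 1#) ^ n + (- 1#) ^ n
      ≈⟨ +-congʳ (-1*x≈-x _) ⟩
    - ((- 1#) ^ n) + (- 1#) ^ n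
      ≈⟨ -‿inverseˡ _ ⟩
    0#  ∎
    where
    coefficient : ∀ k → fromℕ (suc k) * ((- 1#) ^ k * 1/ suc k) ≈ (- 1#) ^ k
    coefficient k = trans (*-congˡ (*-comm _ _)) (1/-cancelˡ (suc k) _)

  substLog-X : substLog X ≋ log1+ₛ
  substLog-X zero    = refl
  substLog-X (suc n) = substLog-suc {X} {log1+ₛ} n (substLog-X n) (begin
    substLog (D X) n         ≈⟨ substLog-cong {D X} {const 1#} D-X n ⟩
    substLog (const 1#) n    ≈⟨ substLog-const 1# n ⟩
    const 1# n               ≈⟨ δ-log1+ n ⟨
    δ log1+ₛ n               ∎)

  δ-1+X : δ (const 1# ⊕ X) ≋ const 1# ⊕ X
  δ-1+X zero = solve 0 ((con 1 :+ con 0) :* (con 0 :+ con 1) :+ con 0 :* (con 1 :+ con 0) := con 1 :+ con 0) refl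
  δ-1+X (suc zero) =
    solve 0 ((con 1 :+ (con 1 :+ con 0)) :* (con 0 :+ con 0) :+ (con 1 :+ con 0) :* (con 0 :+ con 1) := con 0 :+ con 1) refl
  δ-1+X (suc (suc n)) =
    solve 2 (λ a b → a :* (con 0 :+ con 0) :+ b :* (con 0 :+ con 0) := con 0 :+ con 0) refl _ _

  -- The hypotheses characterise e^X, and 1 + X is fixed by `δ` as `δ-1+X` shows. Asking for the
  -- differential equation alone lets the square of e^(X/2) be used without computing its
  -- coefficients.
  substLog-exponential : ∀ {h} → D h ≋ h → h 0 ≈ 1# → substLog h ≋ const 1# ⊕ X
  substLog-exponential h′≈h h₀≈1 zero = trans h₀≈1 (sym (+-identityʳ _))
  substLog-exponential {h} h′≈h h₀≈1 (suc n) = substLog-suc {h} {const 1# ⊕ X} n IH (begin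
    substLog (D h) n       ≈⟨ substLog-cong {D h} {h} h′≈h n ⟩
    substLog h n           ≈⟨ IH ⟩
    (const 1# ⊕ X) n       ≈⟨ δ-1+X n ⟨
    δ (const 1# ⊕ X) n     ∎)
    where
    IH : substLog h n ≈ (const 1# ⊕ X) n
    IH = substLog-exponential h′≈h h₀≈1 n

  -- Coefficients of the substitution

  ⊛-X-zero : ∀ f → (f ⊛ X) 0 ≈ 0#
  ⊛-X-zero f = trans (+-identityʳ _) (zeroʳ _)

  ⊛-X-suc : ∀ f n → (f ⊛ X) (suc n) ≈ f n
  ⊛-X-suc f n = begin
    (f ⊛ X) (suc n)                   ≈⟨ ⊛-comm f X (suc n) ⟩
    0# * f (suc n) + (tail X ⊛ f) n   ≈⟨ trans (+-congʳ (zeroˡ _)) (+-identityˡ _) ⟩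
    (tail X ⊛ f) n                    ≈⟨ ⊛-cong {tail X} {const 1#} {f} tail-X (λ _ → refl) n ⟩
    (const 1# ⊛ f) n                  ≈⟨ const-⊛ 1# f n ⟩
    1# * f n                          ≈⟨ *-identityˡ _ ⟩
    f n                               ∎
    where
    tail-X : tail X ≋ const 1#
    tail-X zero    = refl
    tail-X (suc _) = refl

  -- The recurrence of the falling factorials, with the negative term moved across so that no
  -- subtraction remains.
  S₁-suc : ∀ n m → S₁ (suc n) m + fromℕ n * S₁ n m ≈ (falling n ⊛ X) m
  S₁-suc n m = begin
    (P ⊛ (X ⊖ const a)) m + a * P m             ≈⟨ +-congˡ (const-⊛ a P m) ⟨
    (P ⊛ (X ⊖ const a)) m + (const a ⊛ P) m     ≈⟨ +-congˡ (⊛-comm (const a) P m) ⟩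
    (P ⊛ (X ⊖ const a)) m + (P ⊛ const a) m     ≈⟨ ⊛-distribˡ-⊕ P (X ⊖ const a) (const a) m ⟨
    (P ⊛ ((X ⊖ const a) ⊕ const a)) m
      ≈⟨ ⊛-cong {P} {P} {(X ⊖ const a) ⊕ const a} {X} (λ _ → refl) (λ _ → [x-y]+y≈x _ _) m ⟩
    (P ⊛ X) m                                   ∎
    where
    P = falling n
    a = fromℕ n

  -- The chain rule for `substLog` and the Stirling recurrence are the same recursion in n. The
  -- bound `N` is free because the step uses the hypothesis for `D f` up to `N` and for `f` up to
  -- `suc N`.
  !-substLog : ∀ f {n N} → n ℕ.≤ N → fromℕ (n !) * substLog f n ≈
               ∑[ m ≤ N ] (fromℕ (toℕ m !) * f (toℕ m) * S₁ n (toℕ m))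
  !-substLog f {zero} {N} _ = begin
    fromℕ 1 * f 0
      ≈⟨ trans (+-identityʳ _) (*-identityʳ _) ⟨
    fromℕ 1 * f 0 * 1# + 0#
      ≈⟨ +-congˡ (trans (sum-cong-≋ (λ (_ : Fin N) → zeroʳ _)) (sum-replicate-zero N)) ⟨
    ∑[ m ≤ N ] (fromℕ (toℕ m !) * f (toℕ m) * const 1# (toℕ m))  ∎
  -- The term added to both sides completes the left one to n! times coefficient n of
  -- `δ (substLog f)`, and matches the term n S₁(n, m) of the Stirling recurrence on the right.
  !-substLog f {suc n} {suc N} (s≤s n≤N) = +-cancelʳ (fromℕ n * (fromℕ (n !) * substLog f n)) _ _ (begin
    fromℕ (suc n !) * substLog f (suc n) + fromℕ n * (fromℕ (n !) * substLog f n)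
      ≈⟨ +-congʳ (*-congʳ (fromℕ-* (suc n) (n !))) ⟩
    fromℕ (suc n) * fromℕ (n !) * substLog f (suc n) + fromℕ n * (fromℕ (n !) * substLog f n)
      ≈⟨ solve 5 (λ a b c d e → a :* b :* c :+ d :* (b :* e) := b :* (a :* c :+ d :* e)) refl _ _ _ _ _ ⟩
    fromℕ (n !) * δ (substLog f) n
      ≈⟨ *-congˡ (δ-substLog f n) ⟩
    fromℕ (n !) * substLog (D f) n
      ≈⟨ !-substLog (D f) n≤N ⟩
    ∑[ m ≤ N ] (fromℕ (toℕ m !) * D f (toℕ m) * S₁ n (toℕ m))
      -- The factor m + 1 from `D` turns m! into (m + 1)!, and S₁(n, m) is coefficient m + 1 of
      -- `falling n ⊛ X`. The reindexed sum then gains a term at 0, which is zero because of the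
      -- factor X.
      ≈⟨ sum-cong-≋ {suc N} (λ m → shift (toℕ m)) ⟩
    ∑[ m ≤ N ] (a (suc (toℕ m)) * (falling n ⊛ X) (suc (toℕ m)))
      ≈⟨ trans (+-congʳ (trans (*-congˡ (⊛-X-zero (falling n))) (zeroʳ _))) (+-identityˡ _) ⟨
    ∑[ m ≤ suc N ] (a (toℕ m) * (falling n ⊛ X) (toℕ m))
      ≈⟨ sum-cong-≋ {suc (suc N)} (λ m → split (toℕ m)) ⟩
    ∑[ m ≤ suc N ] (a (toℕ m) * S₁ (suc n) (toℕ m) + fromℕ n * (a (toℕ m) * S₁ n (toℕ m)))
      ≈⟨ ∑-distrib-+ {suc (suc N)} (λ m → a (toℕ m) * S₁ (suc n) (toℕ m))
           (λ m → fromℕ n * (a (toℕ m) * S₁ n (toℕ m))) ⟩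
    ∑[ m ≤ suc N ] (a (toℕ m) * S₁ (suc n) (toℕ m))
      + ∑[ m ≤ suc N ] (fromℕ n * (a (toℕ m) * S₁ n (toℕ m)))
      ≈⟨ +-congˡ (*-distribˡ-sum (fromℕ n) (λ (m : Fin (suc (suc N))) → a (toℕ m) * S₁ n (toℕ m))) ⟨
    ∑[ m ≤ suc N ] (a (toℕ m) * S₁ (suc n) (toℕ m))
      + fromℕ n * (∑[ m ≤ suc N ] (a (toℕ m) * S₁ n (toℕ m)))
      ≈⟨ +-congˡ (*-congˡ (!-substLog f (ℕ.m≤n⇒m≤1+n n≤N))) ⟨
    ∑[ m ≤ suc N ] (a (toℕ m) * S₁ (suc n) (toℕ m)) + fromℕ n * (fromℕ (n !) * substLog f n)  ∎)
    where
    a : ℕ → Carrier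
    a m = fromℕ (m !) * f m
    shift : ∀ m → fromℕ (m !) * D f m * S₁ n m ≈ a (suc m) * (falling n ⊛ X) (suc m)
    shift m = *-cong (begin
      fromℕ (m !) * (fromℕ (suc m) * f (suc m))
        ≈⟨ solve 3 (λ x y z → x :* (y :* z) := (y :* x) :* z) refl _ _ _ ⟩
      fromℕ (suc m) * fromℕ (m !) * f (suc m)
        ≈⟨ *-congʳ (fromℕ-* (suc m) (m !)) ⟨
      a (suc m)  ∎) (sym (⊛-X-suc (falling n) m))
    split : ∀ m → a m * (falling n ⊛ X) m ≈ a m * S₁ (suc n) m + fromℕ n * (a m * S₁ n m)
    split m = trans (*-congˡ (sym (S₁-suc n m)))
      (solve 4 (λ x y z w → x :* (y :+ z :* w) := x :* y :+ z :* (x :* w)) refl _ _ _ _)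

  -- The substitution of ½ log (1 - 4X)

  -- Both scalars are split off into rescalings, themselves multiplicative, so that only log (1 + X)
  -- needs a recursive substitution.
  substHalfLog : PowerSeries → PowerSeries
  substHalfLog f = rescale (- fromℕ 4) (substLog (rescale (1/ 2) f))

  rescale-cong : ∀ a {f g} → f ≋ g → rescale a f ≋ rescale a g
  rescale-cong a eq n = *-congʳ (eq n)

  rescale-⊖ : ∀ a f g → rescale a (f ⊖ g) ≋ rescale a f ⊖ rescale a g
  rescale-⊖ a f g n = trans (distribʳ _ _ _) (+-congˡ (sym (-‿distribˡ-* _ _)))

  rescale-const : ∀ a b → rescale a (const b) ≋ const b
  rescale-const a b zero    = *-identityʳ b
  rescale-const a b (suc n) = zeroˡ _

  substHalfLog-cong : ∀ {f g} → f ≋ g → substHalfLog f ≋ substHalfLog g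
  substHalfLog-cong eq = rescale-cong _ (substLog-cong (rescale-cong _ eq))

  substHalfLog-⊕ : ∀ f g → substHalfLog (f ⊕ g) ≋ substHalfLog f ⊕ substHalfLog g
  substHalfLog-⊕ f g n = trans (*-congʳ (trans
    (substLog-cong {rescale _ (f ⊕ g)} {rescale _ f ⊕ rescale _ g} (λ _ → distribʳ _ _ _) n)
    (substLog-⊕ (rescale _ f) (rescale _ g) n))) (distribʳ _ _ _)

  substHalfLog-⊖ : ∀ f g → substHalfLog (f ⊖ g) ≋ substHalfLog f ⊖ substHalfLog g
  substHalfLog-⊖ f g n = trans (*-congʳ (trans
    (substLog-cong {rescale _ (f ⊖ g)} (rescale-⊖ _ f g) n)
    (substLog-⊖ (rescale _ f) (rescale _ g) n)))
    (rescale-⊖ _ (substLog (rescale _ f)) (substLog (rescale _ g)) n)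

  substHalfLog-⊛ : ∀ f g → substHalfLog (f ⊛ g) ≋ substHalfLog f ⊛ substHalfLog g
  substHalfLog-⊛ f g n = trans (*-congʳ (trans
    (substLog-cong {rescale _ (f ⊛ g)} (rescale-⊛ _ f g) n)
    (substLog-⊛ (rescale _ f) (rescale _ g) n)))
    (rescale-⊛ _ (substLog (rescale _ f)) (substLog (rescale _ g)) n)

  substHalfLog-const : ∀ a → substHalfLog (const a) ≋ const a
  substHalfLog-const a n = trans (*-congʳ (trans
    (substLog-cong (rescale-const (1/ 2) a) n) (substLog-const a n))) (rescale-const _ a n)

  substHalfLog-const-⊛ : ∀ a f → substHalfLog (const a ⊛ f) ≋ const a ⊛ substHalfLog f
  substHalfLog-const-⊛ a f n = trans (substHalfLog-⊛ (const a) f n)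
    (⊛-cong {g = substHalfLog f} (substHalfLog-const a) (λ _ → refl) n)

  substHalfLog-X : substHalfLog X ≋ const (1/ 2) ⊛ log[1-4X]
  substHalfLog-X n = begin
    rescale b (substLog (rescale (1/ 2) X)) n
      ≈⟨ *-congʳ (substLog-cong rescale-X n) ⟩
    rescale b (substLog (const (1/ 2) ⊛ X)) n
      ≈⟨ *-congʳ (substLog-⊛ (const (1/ 2)) X n) ⟩
    rescale b (substLog (const (1/ 2)) ⊛ substLog X) n
      ≈⟨ *-congʳ (⊛-cong (substLog-const (1/ 2)) substLog-X n) ⟩
    rescale b (const (1/ 2) ⊛ log1+ₛ) n
      ≈⟨ rescale-⊛ b (const (1/ 2)) log1+ₛ n ⟩
    (rescale b (const (1/ 2)) ⊛ log[1-4X]) n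
      ≈⟨ ⊛-cong {g = log[1-4X]} (rescale-const b (1/ 2)) (λ _ → refl) n ⟩
    (const (1/ 2) ⊛ log[1-4X]) n  ∎
    where
    b = - fromℕ 4
    rescale-X : rescale (1/ 2) X ≋ const (1/ 2) ⊛ X
    rescale-X k = trans (pointwise k) (sym (const-⊛ (1/ 2) X k))
      where
      pointwise : rescale (1/ 2) X ≋ scale (1/ 2) X
      pointwise zero          = trans (zeroˡ _) (sym (zeroʳ _))
      pointwise (suc zero)    = *-identityˡ _
      pointwise (suc (suc k)) = trans (zeroˡ _) (sym (zeroʳ _))

  !⁻¹-inverseʳ : ∀ n → fromℕ (n !) * n !⁻¹ ≈ 1#
  !⁻¹-inverseʳ n = 1/-inverseʳ (n !) {{n ℕ.!≢0}}

  !⁻¹-zero : 0 !⁻¹ ≈ 1#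
  !⁻¹-zero = trans (sym (*-identityˡ _)) (trans (*-congʳ (sym (+-identityʳ 1#))) (!⁻¹-inverseʳ 0))

  D-exp : D expₛ ≋ expₛ
  D-exp n = fromℕ-cancelˡ (n !) {{n ℕ.!≢0}} (begin
    fromℕ (n !) * (fromℕ (suc n) * suc n !⁻¹)
      ≈⟨ solve 3 (λ x y z → x :* (y :* z) := (y :* x) :* z) refl _ _ _ ⟩
    fromℕ (suc n) * fromℕ (n !) * suc n !⁻¹     ≈⟨ *-congʳ (fromℕ-* (suc n) (n !)) ⟨
    fromℕ (suc n !) * suc n !⁻¹                 ≈⟨ !⁻¹-inverseʳ (suc n) ⟩
    1#                                          ≈⟨ !⁻¹-inverseʳ n ⟨
    fromℕ (n !) * n !⁻¹                         ∎)

  1-4X-coeff : rescale (- fromℕ 4) (const 1# ⊕ X) ≋ 1-4X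
  1-4X-coeff n = trans (pointwise n) (+-congˡ (-‿cong (sym (const-⊛ (fromℕ 4) X n))))
    where
    pointwise : rescale (- fromℕ 4) (const 1# ⊕ X) ≋ const 1# ⊖ scale (fromℕ 4) X
    pointwise zero = trans (*-identityʳ _) (+-congˡ (trans (sym -0#≈0#) (-‿cong (sym (zeroʳ _)))))
    pointwise (suc zero) = begin
      (0# + 1#) * (- fromℕ 4 * 1#)   ≈⟨ *-cong (+-identityˡ _) (*-identityʳ _) ⟩
      1# * - fromℕ 4                 ≈⟨ *-identityˡ _ ⟩
      - fromℕ 4                      ≈⟨ -‿cong (*-identityʳ _) ⟨
      - (fromℕ 4 * 1#)               ≈⟨ +-identityˡ _ ⟨
      0# - fromℕ 4 * 1#              ∎
    pointwise (suc (suc n)) = begin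
      (0# + 0#) * _                  ≈⟨ trans (*-congʳ (+-identityˡ _)) (zeroˡ _) ⟩
      0#                             ≈⟨ -‿inverseʳ 0# ⟨
      0# - 0#                        ≈⟨ +-congˡ (-‿cong (zeroʳ _)) ⟨
      0# - fromℕ 4 * 0#              ∎

  -- The square of `e` = e^(X/2) is its own derivative, since ½ + ½ = 1, and has constant
  -- coefficient 1. Hence log (1 + X) takes it to 1 + X, and rescaling gives 1 - 4X.
  substHalfLog-exp-square : substHalfLog expₛ ⊛ substHalfLog expₛ ≋ 1-4X
  substHalfLog-exp-square n = begin
    (substHalfLog expₛ ⊛ substHalfLog expₛ) n
      ≈⟨ rescale-⊛ b (substLog e) (substLog e) n ⟨
    rescale b (substLog e ⊛ substLog e) n
      ≈⟨ *-congʳ (substLog-⊛ e e n) ⟨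
    rescale b (substLog (e ⊛ e)) n
      ≈⟨ *-congʳ (substLog-exponential {e ⊛ e} D-e² e²₀ n) ⟩
    rescale b (const 1# ⊕ X) n
      ≈⟨ 1-4X-coeff n ⟩
    1-4X n  ∎
    where
    b = - fromℕ 4
    e = rescale (1/ 2) expₛ

    D-e : D e ≋ scale (1/ 2) e
    D-e k = trans (solve 4 (λ x y z w → x :* (y :* (z :* w)) := z :* (x :* y :* w)) refl _ _ _ _)
                  (*-congˡ (*-congʳ (D-exp k)))

    D-e² : D (e ⊛ e) ≋ e ⊛ e
    D-e² k = begin
      D (e ⊛ e) k
        ≈⟨ D-⊛ e e k ⟩
      (D e ⊛ e) k + (e ⊛ D e) k
        ≈⟨ +-cong (⊛-cong {g = e} D-e (λ _ → refl) k) (⊛-cong {e} (λ _ → refl) D-e k) ⟩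
      (scale (1/ 2) e ⊛ e) k + (e ⊛ scale (1/ 2) e) k
        ≈⟨ +-cong (scale-⊛ (1/ 2) e e k) (⊛-scale (1/ 2) e e k) ⟩
      1/ 2 * (e ⊛ e) k + 1/ 2 * (e ⊛ e) k
        ≈⟨ solve 2 (λ x y → x :* y :+ x :* y := (con 1 :+ (con 1 :+ con 0)) :* (x :* y)) refl _ _ ⟩
      fromℕ 2 * (1/ 2 * (e ⊛ e) k)
        ≈⟨ 1/-cancelˡ 2 _ ⟩
      (e ⊛ e) k  ∎

    e₀ : e 0 ≈ 1#
    e₀ = trans (*-identityʳ _) !⁻¹-zero

    e²₀ : (e ⊛ e) 0 ≈ 1#
    e²₀ = trans (+-identityʳ _) (trans (*-cong e₀ e₀) (*-identityˡ _))

  -- Both series are square roots of 1 - 4X with constant coefficient 1.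
  substHalfLog-exp : ∀ {s} → Is√[1-4X] s → substHalfLog expₛ ≋ s
  substHalfLog-exp {s} (s₀≈1 , s²≈1-4X) = sqrt-unique
    (trans (*-identityʳ _) (trans (*-identityʳ _) !⁻¹-zero)) s₀≈1
    (λ n → trans (substHalfLog-exp-square n) (sym (s²≈1-4X n)))

  -- Powers of 2 and the Stirling formula for the coefficients.

  ^-distrib-* : ∀ x y n → (x * y) ^ n ≈ x ^ n * y ^ n
  ^-distrib-* = CommutativeExp.^-distrib-* commutativeSemiring

  ^-cong : ∀ {x y} n → x ≈ y → x ^ n ≈ y ^ n
  ^-cong n = SemiringExp.^-congˡ semiring n

  1^n≈1 : ∀ n → 1# ^ n ≈ 1#
  1^n≈1 zero    = refl
  1^n≈1 (suc n) = trans (*-identityˡ _) (1^n≈1 n)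

  -1^n*-x^n : ∀ x n → (- 1#) ^ n * (- x) ^ n ≈ x ^ n
  -1^n*-x^n x n = trans (sym (^-distrib-* (- 1#) (- x) n))
    (^-cong n (trans (-1*x≈-x _) (-‿involutive x)))

  -- The origin of 2^(2n - m): 4^n comes from the outer rescaling and (1/2)^m from the inner one.
  -- The bound on m makes the truncated subtraction a true one.
  4^n*½^m : ∀ {m n} → m ℕ.≤ n → fromℕ 4 ^ n * (1/ 2) ^ m ≈ fromℕ 2 ^ (2 ℕ.* n ℕ.∸ m)
  4^n*½^m {m} {n} m≤n = begin
    fromℕ 4 ^ n * (1/ 2) ^ m
      ≈⟨ *-congʳ (^-cong n (trans (fromℕ-* 2 2) (*-congˡ (sym (*-identityʳ _))))) ⟩
    (fromℕ 2 ^ 2) ^ n * (1/ 2) ^ m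
      ≈⟨ *-congʳ (SemiringExp.^-assocʳ semiring (fromℕ 2) 2 n) ⟩
    fromℕ 2 ^ (2 ℕ.* n) * (1/ 2) ^ m
      ≡⟨ ≡.cong (λ k → fromℕ 2 ^ k * (1/ 2) ^ m) (ℕ.m∸n+n≡m (ℕ.≤-trans m≤n (ℕ.m≤m+n n _))) ⟨
    fromℕ 2 ^ (2 ℕ.* n ℕ.∸ m ℕ.+ m) * (1/ 2) ^ m
      ≈⟨ *-congʳ (SemiringExp.^-homo-* semiring (fromℕ 2) (2 ℕ.* n ℕ.∸ m) m) ⟩
    fromℕ 2 ^ (2 ℕ.* n ℕ.∸ m) * fromℕ 2 ^ m * (1/ 2) ^ m
      ≈⟨ *-assoc _ _ _ ⟩
    fromℕ 2 ^ (2 ℕ.* n ℕ.∸ m) * (fromℕ 2 ^ m * (1/ 2) ^ m)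
      ≈⟨ *-congˡ (^-distrib-* (fromℕ 2) (1/ 2) m) ⟨
    fromℕ 2 ^ (2 ℕ.* n ℕ.∸ m) * (fromℕ 2 * 1/ 2) ^ m
      ≈⟨ *-congˡ (trans (^-cong m (1/-inverseʳ 2)) (1^n≈1 m)) ⟩
    fromℕ 2 ^ (2 ℕ.* n ℕ.∸ m) * 1#
      ≈⟨ *-identityʳ _ ⟩
    fromℕ 2 ^ (2 ℕ.* n ℕ.∸ m)  ∎

  -- The sign (-1)^n turns (-4)^n into 4^n, and the m! produced by `!-substLog` cancels the `m !⁻¹`
  -- of the exponential generating function.
  substHalfLog-coeff : ∀ (B : ℕ → Carrier) n → (- 1#) ^ n * substHalfLog (λ m → B m * m !⁻¹) n ≈
    n !⁻¹ * (∑[ m ≤ n ] (fromℕ 2 ^ (2 ℕ.* n ℕ.∸ toℕ m) * B (toℕ m) * S₁ n (toℕ m)))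
  substHalfLog-coeff B n = begin
    (- 1#) ^ n * (substLog f n * (- fromℕ 4) ^ n)
      ≈⟨ solve 3 (λ x y z → x :* (y :* z) := (x :* z) :* y) refl _ _ _ ⟩
    (- 1#) ^ n * (- fromℕ 4) ^ n * substLog f n
      ≈⟨ *-congʳ (-1^n*-x^n (fromℕ 4) n) ⟩
    fromℕ 4 ^ n * substLog f n
      ≈⟨ *-congˡ (1/-cancelˡ (n !) {{n ℕ.!≢0}} (substLog f n)) ⟨
    fromℕ 4 ^ n * (fromℕ (n !) * (n !⁻¹ * substLog f n))
      ≈⟨ solve 4 (λ x y z w → x :* (y :* (z :* w)) := z :* (x :* (y :* w))) refl _ _ _ _ ⟩
    n !⁻¹ * (fromℕ 4 ^ n * (fromℕ (n !) * substLog f n))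
      ≈⟨ *-congˡ (*-congˡ (!-substLog f (ℕ.≤-refl {n}))) ⟩
    n !⁻¹ * (fromℕ 4 ^ n * (∑[ m ≤ n ] (fromℕ (toℕ m !) * f (toℕ m) * S₁ n (toℕ m))))
      ≈⟨ *-congˡ (*-distribˡ-sum (fromℕ 4 ^ n)
           (λ (m : Fin (suc n)) → fromℕ (toℕ m !) * f (toℕ m) * S₁ n (toℕ m))) ⟩
    n !⁻¹ * (∑[ m ≤ n ] (fromℕ 4 ^ n * (fromℕ (toℕ m !) * f (toℕ m) * S₁ n (toℕ m))))
      ≈⟨ *-congˡ (sum-cong-≋ {suc n} (λ m → term (toℕ m) (toℕ≤pred[n] m))) ⟩
    n !⁻¹ * (∑[ m ≤ n ] (fromℕ 2 ^ (2 ℕ.* n ℕ.∸ toℕ m) * B (toℕ m) * S₁ n (toℕ m)))  ∎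
    where
    f : PowerSeries
    f = rescale (1/ 2) (λ m → B m * m !⁻¹)
    term : ∀ m → m ℕ.≤ n → fromℕ 4 ^ n * (fromℕ (m !) * f m * S₁ n m)
                         ≈ fromℕ 2 ^ (2 ℕ.* n ℕ.∸ m) * B m * S₁ n m
    term m m≤n = begin
      fromℕ 4 ^ n * (fromℕ (m !) * (B m * m !⁻¹ * (1/ 2) ^ m) * S₁ n m)
        ≈⟨ solve 6 (λ a b c d e g → a :* (b :* (c :* d :* e) :* g)
                                 := (b :* d) :* ((a :* e) :* c :* g)) refl _ _ _ _ _ _ ⟩
      fromℕ (m !) * m !⁻¹ * (fromℕ 4 ^ n * (1/ 2) ^ m * B m * S₁ n m)
        ≈⟨ *-cong (!⁻¹-inverseʳ m) (*-congʳ (*-congʳ (4^n*½^m m≤n))) ⟩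
      1# * (fromℕ 2 ^ (2 ℕ.* n ℕ.∸ m) * B m * S₁ n m)
        ≈⟨ *-identityˡ _ ⟩
      fromℕ 2 ^ (2 ℕ.* n ℕ.∸ m) * B m * S₁ n m  ∎

  -- Uniqueness of the quotient

  -- Equality is ¬¬-stable by tightness, which licenses the case split on g 0.
  ⊛-cancelˡ : ∀ g {f h} → (g 0 ≈ 0# → Σ[ u ∈ Carrier ] g 1 * u ≈ 1#) →
              g ⊛ f ≋ g ⊛ h → f ≋ h
  ⊛-cancelˡ g {f} {h} g₁-unit eq n = proj₁ (tight _ _) λ fn#hn →
    -- Were `g 0` apart from zero, it would be invertible, and cancellation would contradict
    -- `fn#hn`. So `g 0` is zero, and `tail g`, whose constant coefficient `g 1` is a unit, can be
    -- cancelled instead.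
    let g₀≈0 = proj₁ (tight (g 0) 0#) λ g₀#0 →
          let (u , _ , [g₀-0]u≈1) = #⇒invertible g₀#0
              g₀u≈1 = trans (*-congʳ (sym (trans (+-congˡ -0#≈0#) (+-identityʳ _)))) [g₀-0]u≈1
          in proj₂ (tight _ _) (invertible-⊛-cancelˡ g u g₀u≈1 eq n) fn#hn
        (u , g₁u≈1) = g₁-unit g₀≈0
    in proj₂ (tight _ _)
         (invertible-⊛-cancelˡ (tail g) u g₁u≈1 (⊛-tailˡ {g} {f} {h} g₀≈0 eq) n) fn#hn

  -- Comparing linear coefficients in s² = 1 - 4X gives 2 s₁ = -4, so multiplying by 2 and then by
  -- -1/4 inverts s₁.
  √[1-4X]-coeff₁ : ∀ {s} → Is√[1-4X] s → s 1 * (fromℕ 2 * - 1/ 4) ≈ 1#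
  √[1-4X]-coeff₁ {s} (s₀≈1 , s²≈1-4X) = begin
    s 1 * (fromℕ 2 * - 1/ 4)
      ≈⟨ solve 2 (λ x y → x :* ((con 1 :+ (con 1 :+ con 0)) :* y)
                       := (con 1 :* x :+ (x :* con 1 :+ con 0)) :* y) refl (s 1) (- 1/ 4) ⟩
    (1# * s 1 + (s 1 * 1# + 0#)) * - 1/ 4
      ≈⟨ *-congʳ (+-cong (*-congʳ s₀≈1) (+-congʳ (*-congˡ s₀≈1))) ⟨
    (s ⊛ s) 1 * - 1/ 4
      ≈⟨ *-congʳ (trans (s²≈1-4X 1) (+-congˡ (-‿cong
           (trans (const-⊛ (fromℕ 4) X 1) (*-identityʳ _))))) ⟩
    (0# - fromℕ 4) * - 1/ 4
      ≈⟨ *-congʳ (+-identityˡ _) ⟩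
    - fromℕ 4 * - 1/ 4
      ≈⟨ trans (sym (-‿distribˡ-* _ _)) (-‿cong (sym (-‿distribʳ-* _ _))) ⟩
    - - (fromℕ 4 * 1/ 4)
      ≈⟨ trans (-‿involutive _) (1/-inverseʳ 4) ⟩
    1#  ∎

  -- The constant coefficient is q - 1. If it vanishes then q = 1, and the linear coefficient is
  -- that of √(1 - 4X), namely -2.
  qs-1-unit : ∀ {q s} → Is√[1-4X] s → let g = const q ⊛ s ⊖ const 1# in
              g 0 ≈ 0# → Σ[ u ∈ Carrier ] g 1 * u ≈ 1#
  qs-1-unit {q} {s} √s@(s₀≈1 , _) g₀≈0 = fromℕ 2 * - 1/ 4 , (begin
    ((const q ⊛ s) 1 - 0#) * (fromℕ 2 * - 1/ 4)
      ≈⟨ *-congʳ (trans (+-congˡ -0#≈0#) (trans (+-identityʳ _) (const-⊛ q s 1))) ⟩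
    q * s 1 * (fromℕ 2 * - 1/ 4)
      ≈⟨ *-congʳ (trans (*-congʳ q≈1) (*-identityˡ _)) ⟩
    s 1 * (fromℕ 2 * - 1/ 4)
      ≈⟨ √[1-4X]-coeff₁ √s ⟩
    1#  ∎)
    where
    q≈1 : q ≈ 1#
    q≈1 = begin
      q                 ≈⟨ trans (*-congˡ s₀≈1) (*-identityʳ _) ⟨
      q * s 0           ≈⟨ const-⊛ q s 0 ⟨
      (const q ⊛ s) 0   ≈⟨ x-y≈0⇒x≈y _ _ g₀≈0 ⟩
      1#                ∎

  -- Comparison of the two generating functions.

  substHalfLog-qBernoulli : ∀ {q κ B d} → IsQBernoulli q κ B → IsQCatalanDaehee q κ d →
                            d ≋ substHalfLog (λ m → B m * m !⁻¹)
  substHalfLog-qBernoulli {q} {κ} {B} {d} isB (s , √s , isD) =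
    ⊛-cancelˡ (const q ⊛ s ⊖ const 1#) {d} (qs-1-unit √s) λ n → begin
      ((const q ⊛ s ⊖ const 1#) ⊛ d) n
        ≈⟨ isD n ⟩
      (const (q - 1#) ⊕ const κ ⊛ (const (1/ 2) ⊛ log[1-4X])) n
        ≈⟨ +-cong (substHalfLog-const (q - 1#) n)
             (trans (substHalfLog-const-⊛ κ X n)
                    (⊛-cong {const κ} (λ _ → refl) substHalfLog-X n)) ⟨
      substHalfLog (const (q - 1#)) n + substHalfLog (const κ ⊛ X) n
        ≈⟨ substHalfLog-⊕ (const (q - 1#)) (const κ ⊛ X) n ⟨
      substHalfLog (const (q - 1#) ⊕ const κ ⊛ X) n
        -- The numerator for d is by now the substituted numerator for B, so the defining equation
        -- of B can be inserted under the substitution.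
        ≈⟨ substHalfLog-cong isB n ⟨
      substHalfLog ((const q ⊛ expₛ ⊖ const 1#) ⊛ b) n
        ≈⟨ substHalfLog-⊛ (const q ⊛ expₛ ⊖ const 1#) b n ⟩
      (substHalfLog (const q ⊛ expₛ ⊖ const 1#) ⊛ substHalfLog b) n
        ≈⟨ ⊛-cong {g = substHalfLog b} denominator (λ _ → refl) n ⟩
      ((const q ⊛ s ⊖ const 1#) ⊛ substHalfLog b) n  ∎
    where
    b : PowerSeries
    b m = B m * m !⁻¹
    denominator : substHalfLog (const q ⊛ expₛ ⊖ const 1#) ≋ const q ⊛ s ⊖ const 1#
    denominator k = trans (substHalfLog-⊖ (const q ⊛ expₛ) (const 1#) k)
      (+-cong (trans (substHalfLog-const-⊛ q expₛ k)
                     (⊛-cong {const q} (λ _ → refl) (substHalfLog-exp √s) k))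
              (-‿cong (substHalfLog-const 1# k)))

theorem2 : ∀ (p : ℕ) (p-prime : Prime p) → p ≢ 2 →
    ∀ {c ℓ₁ ℓ₂} (ℂₚ : PadicComplexField p c ℓ₁ ℓ₂) →
    let open PadicComplexField ℂₚ
        open CatalanDaehee ℂₚ
    in
    ∀ (q : Carrier) → ∣ 1# - q ∣<p^- (1/[p-1] p p-prime) →
    ∀ (log-q κ : Carrier) → IsLog q log-q → κ * log-q ≈ q - 1# →
    ∀ (B d : ℕ → Carrier) → IsQBernoulli q κ B → IsQCatalanDaehee q κ d →
    ∀ (n : ℕ) →
    (- 1#) ^ n * d n ≈
      n !⁻¹ * (∑[ m ≤ n ] (fromℕ 2 ^ (2 ℕ.* n ℕ.∸ toℕ m) * B (toℕ m) * S₁ n (toℕ m)))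
theorem2 p _ _ ℂₚ q _ log-q κ _ _ B d isB isD n =
  trans (*-congˡ (substHalfLog-qBernoulli isB isD n)) (substHalfLog-coeff B n)
  where
  open PadicComplexField ℂₚ using (trans; *-congˡ)
  open LogSubstitution ℂₚ
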